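{- Let $k\ge 2$ and let $\alpha_1,\dots,\alpha_k$ be nonnegative rational numbers such that the sum of any $k-1$ of them is at most $1$ and $\alpha_1+\cdots+\alpha_k>1$. For every integer $g\ge 0$, the number $f(g)$ of $\alpha$-communal $k$-tuples whose entries sum to $g$ equals \[ f(g)=\binom{\sum_{i=1}^k \lfloor \alpha_i g\rfloor - g + k-1}{k-1}, \] where, as usual, $\binom{n}{r}=0$ for integers $0\le n<r$.
   Context: A $k$-tuple $[g_1,\dots,g_k]$ of integers is called $\alpha$-communal (for $\alpha=(\alpha_1,\dots,\alpha_k)$) if $0\le g_i\le \alpha_i\sum_{j=1}^k g_j$ for every $i$. For an integer $g\ge 0$, $f(g)$ denotes the number of $\alpha$-communal $k$-tuples $[g_1,\dots,g_k]$ with $\sum_i g_i=g$. -}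

module Defs where

open import Data.Fin.Base using (Fin; zero; suc)
open import Data.Fin.Properties using (all?)
open import Data.Integer.Base as ℤ using (ℤ; +_; -[1+_]; 0ℤ; -1ℤ; +≤+)
import Data.Integer.Properties as ℤ
open import Data.List.Base using (List; []; _∷_; length; map; filter; upTo; cartesianProductWith)
open import Data.List.Membership.Propositional using (_∈_)
open import Data.List.Membership.Propositional.Properties
  using (∈-map⁺; ∈-upTo⁺; ∈-cartesianProductWith⁺; ∈-filter⁺; ∈-filter⁻)
open import Data.List.Relation.Unary.All using ([])
open import Data.List.Relation.Unary.AllPairs using ([]; _∷_)
open import Data.List.Relation.Unary.Any using (here)
open import Data.List.Relation.Unary.Unique.Propositional using (Unique)
open import Data.List.Relation.Unary.Unique.Propositional.Properties
  using (map⁺; upTo⁺; filter⁺; cartesianProductWith⁺)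
open import Data.Nat.Base as ℕ using (ℕ; zero; suc; s≤s)
open import Data.Nat.Combinatorics using (_C_)
open import Data.Product.Base using (_×_; _,_; proj₁; proj₂)
open import Data.Rational.Base as ℚ using (ℚ)
import Data.Rational.Properties as ℚ
open import Data.Vec.Base using (Vec; []; _∷_; lookup)
open import Data.Vec.Functional using (Vector)
open import Data.Vec.Properties using (∷-injective)
open import Function.Base using (_∘_)
open import Function.Bundles using (_⇔_; mk⇔)
open import Relation.Binary.PropositionalEquality using (_≡_; refl; sym; subst)
open import Relation.Nullary.Decidable using (Dec; _×-dec_)

open import Algebra.Properties.CommutativeMonoid.Sum ℤ.+-0-commutativeMonoid public
  using () renaming (sum to ∑ℤ)
open import Algebra.Properties.CommutativeMonoid.Sum ℚ.+-0-commutativeMonoid public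
  using () renaming (sum to ∑ℚ)

private
  variable
    k : ℕ

fromℤ : ℤ → ℚ
fromℤ z = z ℚ./ 1

Communal : Vector ℚ k → Vec ℤ k → Set
Communal α t = ∀ i → 0ℤ ℤ.≤ lookup t i
                   × fromℤ (lookup t i) ℚ.≤ α i ℚ.* fromℤ (∑ℤ (lookup t))

CommunalOfSum : Vector ℚ k → ℕ → Vec ℤ k → Set
CommunalOfSum α g t = Communal α t × ∑ℤ (lookup t) ≡ + g

communalOfSum? : ∀ (α : Vector ℚ k) g t → Dec (CommunalOfSum α g t)
communalOfSum? α g t =
  all? (λ i → (0ℤ ℤ.≤? lookup t i)
        ×-dec (fromℤ (lookup t i) ℚ.≤? α i ℚ.* fromℤ (∑ℤ (lookup t))))
  ×-dec (∑ℤ (lookup t) ℤ.≟ + g)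

-- All k-tuples of integers with entries in {0, …, g}.
box : ∀ k → ℕ → List (Vec ℤ k)
box zero    g = [] ∷ []
box (suc k) g = cartesianProductWith _∷_ (map +_ (upTo (suc g))) (box k g)

-- Restricting to the box loses nothing: see ∈-communalTuples.
communalTuples : Vector ℚ k → ℕ → List (Vec ℤ k)
communalTuples {k} α g = filter (communalOfSum? α g) (box k g)

f : Vector ℚ k → ℕ → ℕ
f α g = length (communalTuples α g)

-- Binomial coefficient with an integer upper index n, given by
-- n (n - 1) ⋯ (n - r + 1) / r!.  For negative n this is the usual
-- C(-(m + 1), r) = (-1)^r C(m + r, r).
binom : ℤ → ℕ → ℤ
binom (+ n)    r = + (n C r)
binom -[1+ m ] r = -1ℤ ℤ.^ r ℤ.* + ((m ℕ.+ r) C r)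

------------------------------------------------------------------------
-- communalTuples lists every tuple satisfying CommunalOfSum exactly
-- once, so that f α g is indeed the number of these tuples.

box-unique : ∀ k g → Unique (box k g)
box-unique zero    g = [] ∷ []
box-unique (suc k) g = cartesianProductWith⁺ _∷_ ∷-injective
  (map⁺ ℤ.+-injective (upTo⁺ (suc g))) (box-unique k g)

communalTuples-unique : ∀ (α : Vector ℚ k) g → Unique (communalTuples α g)
communalTuples-unique {k} α g = filter⁺ (communalOfSum? α g) (box-unique k g)

∑ℤ-nonneg : (v : Vector ℤ k) → (∀ i → 0ℤ ℤ.≤ v i) → 0ℤ ℤ.≤ ∑ℤ v
∑ℤ-nonneg {zero}  v p = ℤ.≤-refl
∑ℤ-nonneg {suc k} v p = ℤ.+-mono-≤ (p zero) (∑ℤ-nonneg (v ∘ suc) (p ∘ suc))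

entry≤∑ℤ : (v : Vector ℤ k) → (∀ i → 0ℤ ℤ.≤ v i) → ∀ i → v i ℤ.≤ ∑ℤ v
entry≤∑ℤ v p zero = subst (ℤ._≤ ∑ℤ v) (ℤ.+-identityʳ (v zero))
  (ℤ.+-monoʳ-≤ (v zero) (∑ℤ-nonneg (v ∘ suc) (p ∘ suc)))
entry≤∑ℤ v p (suc i) = subst (ℤ._≤ ∑ℤ v) (ℤ.+-identityˡ (v (suc i)))
  (ℤ.+-mono-≤ (p zero) (entry≤∑ℤ (v ∘ suc) (p ∘ suc) i))

∈-interval : ∀ {z g} → 0ℤ ℤ.≤ z → z ℤ.≤ + g → z ∈ map +_ (upTo (suc g))
∈-interval (+≤+ _) (+≤+ n≤g) = ∈-map⁺ +_ (∈-upTo⁺ (s≤s n≤g))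

∈-box : ∀ {g} (t : Vec ℤ k) → (∀ i → 0ℤ ℤ.≤ lookup t i) →
        (∀ i → lookup t i ℤ.≤ + g) → t ∈ box k g
∈-box []      p q = here refl
∈-box (z ∷ t) p q = ∈-cartesianProductWith⁺ _∷_
  (∈-interval (p zero) (q zero)) (∈-box t (p ∘ suc) (q ∘ suc))

∈-communalTuples : ∀ (α : Vector ℚ k) g t →
                   t ∈ communalTuples α g ⇔ CommunalOfSum α g t
∈-communalTuples {k} α g t = mk⇔
  (λ t∈ → proj₂ (∈-filter⁻ (communalOfSum? α g) {xs = box k g} t∈))
  (λ c@(communal , ∑≡g) → ∈-filter⁺ (communalOfSum? α g)
    (∈-box t (proj₁ ∘ communal) λ i →
      subst (lookup t i ℤ.≤_) ∑≡g (entry≤∑ℤ (lookup t) (proj₁ ∘ communal) i))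
    c)

{-# OPTIONS --safe #-}
module Submission where

-- Put mᵢ = ⌊αᵢ g⌋ and N = ∑ mᵢ − g.  The substitution hᵢ = mᵢ − gᵢ turns the
-- α-communal tuples of sum g into the tuples of sum N with 0 ≤ hᵢ ≤ mᵢ.  Since
-- any k − 1 of the mᵢ sum to at most g, we have N ≤ mᵢ, so the upper bounds
-- hold automatically and stars and bars counts C(N + k − 1, k − 1) tuples.
-- If N < 0 there are none; then ∑ αᵢ > 1 gives N > −k, so the upper index of
-- the binomial coefficient is a natural number below k − 1.

open import Defs
open import Algebra.Bundles using (AbelianGroup; CommutativeRing)
import Algebra.Properties.Group as Group
import Algebra.Properties.Semiring.Sum as SemiringSum
open import Data.Fin.Base using (Fin; zero; suc; punchIn)
open import Data.Fin.Properties using (punchIn-injective)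
open import Data.Integer.Base as ℤ using (ℤ; -[1+_]; +_; _+_; _-_; 0ℤ; 1ℤ; +≤+; +<+; -<+)
import Data.Integer.DivMod as ℤ
import Data.Integer.Properties as ℤ
open import Data.Integer.Tactic.RingSolver using (solve-∀)
open import Data.List.Base using (List; []; _∷_; _++_; length; map)
open import Data.List.Membership.Propositional using (_∈_)
open import Data.List.Membership.Propositional.Properties
  using (∈-map⁺; ∈-map⁻; ∈-++⁺ˡ; ∈-++⁺ʳ; ∈-++⁻)
open import Data.List.Membership.Propositional.Properties.WithK using (unique∧set⇒bag)
open import Data.List.Properties using (length-++; length-map)
open import Data.List.Relation.Binary.BagAndSetEquality using (∼bag⇒↭)
open import Data.List.Relation.Binary.Permutation.Propositional.Properties using (↭-length)
open import Data.List.Relation.Unary.All using ([])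
open import Data.List.Relation.Unary.AllPairs using ([]; _∷_)
open import Data.List.Relation.Unary.Any using (here)
open import Data.List.Relation.Unary.Unique.Propositional using (Unique)
import Data.List.Relation.Unary.Unique.Propositional.Properties as Unique
open import Data.Nat.Base as ℕ using (ℕ; zero; suc; _≤_; _∸_; z≤n)
open import Data.Nat.Combinatorics
  using (_C_; nCn≡1; nCk≡nC[n∸k]; nCk+nC[k+1]≡[n+1]C[k+1]; k>n⇒nCk≡0)
import Data.Nat.Coprimality as Coprime
import Data.Nat.Properties as ℕ
open import Data.Product.Base using (_×_; _,_; proj₁; proj₂)
open import Data.Rational.Base as ℚ using (ℚ; mkℚ; 0ℚ; 1ℚ; floor; *≤*; *<*; ↥_; ↧_; ↧ₙ_)
import Data.Rational.Properties as ℚ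
open import Data.Sum.Base using (inj₁; inj₂)
open import Data.Vec.Base using (Vec; []; _∷_; lookup)
import Data.Vec.Functional as Vector
open import Data.Vec.Functional using (Vector)
open import Data.Vec.Properties using (∷-injectiveʳ)
open import Function.Base using (_∘_)
open import Function.Bundles using (_⇔_; mk⇔; Equivalence)
open import Function.Definitions using (Injective)
open import Relation.Binary.PropositionalEquality
  using (_≡_; refl; sym; trans; cong; cong₂; subst; subst₂; module ≡-Reasoning)
open import Relation.Nullary using (¬_; yes; no; contradiction)

open SemiringSum (CommutativeRing.semiring ℚ.+-*-commutativeRing) using (*-distribʳ-sum)
open import Algebra.Properties.CommutativeMonoid.Sum ℤ.+-0-commutativeMonoid using (sum-remove)

open Group (AbelianGroup.group ℤ.+-0-abelianGroup) using () renaming (∙-cancelˡ to +-cancelˡ)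

private
  variable
    k : ℕ

-- Integers inside the rationals, and the floor

-- `fromℤ z` normalises by a gcd and so is stuck on a variable `z`; the `mkℚ` form exposes numerator
-- and denominator.
fromℤ≡mkℚ : ∀ z → fromℤ z ≡ mkℚ z 0 (Coprime.sym (Coprime.1-coprimeTo ℤ.∣ z ∣))
fromℤ≡mkℚ z = ℚ.fromℚᵘ-toℚᵘ (mkℚ z 0 (Coprime.sym (Coprime.1-coprimeTo ℤ.∣ z ∣)))

fromℤ-+ : ∀ x y → fromℤ (x + y) ≡ fromℤ x ℚ.+ fromℤ y
fromℤ-+ x y = trans
  (cong fromℤ (cong₂ _+_ (sym (ℤ.*-identityʳ x)) (sym (ℤ.*-identityʳ y))))
  (sym (cong₂ ℚ._+_ (fromℤ≡mkℚ x) (fromℤ≡mkℚ y)))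

fromℤ-mono-≤ : ∀ {x y} → x ℤ.≤ y → fromℤ x ℚ.≤ fromℤ y
fromℤ-mono-≤ {x} {y} x≤y rewrite fromℤ≡mkℚ x | fromℤ≡mkℚ y =
  *≤* (ℤ.*-monoʳ-≤-nonNeg 1ℤ x≤y)

fromℤ-cancel-≤ : ∀ {x y} → fromℤ x ℚ.≤ fromℤ y → x ℤ.≤ y
fromℤ-cancel-≤ {x} {y} p rewrite fromℤ≡mkℚ x | fromℤ≡mkℚ y =
  subst₂ ℤ._≤_ (ℤ.*-identityʳ x) (ℤ.*-identityʳ y) (ℚ.drop-*≤* p)

fromℤ-cancel-< : ∀ {x y} → fromℤ x ℚ.< fromℤ y → x ℤ.< y
fromℤ-cancel-< {x} {y} p rewrite fromℤ≡mkℚ x | fromℤ≡mkℚ y =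
  subst₂ ℤ._<_ (ℤ.*-identityʳ x) (ℤ.*-identityʳ y) (ℚ.drop-*<* p)

floor≤ : ∀ p → fromℤ (floor p) ℚ.≤ p
floor≤ p@record{} rewrite fromℤ≡mkℚ (floor p) =
  *≤* (subst (floor p ℤ.* ↧ p ℤ.≤_) (sym (ℤ.*-identityʳ (↥ p))) (ℤ.[n/d]*d≤n (↥ p) (↧ p)))

<suc-floor : ∀ p → p ℚ.< fromℤ (ℤ.suc (floor p))
<suc-floor p@record{} rewrite fromℤ≡mkℚ (ℤ.suc (floor p)) =
  *<* (subst₂ ℤ._<_ (sym (ℤ.*-identityʳ (↥ p)))
    (cong (λ z → ℤ.suc z ℤ.* ↧ p) (sym (ℤ.div-pos-is-/ℕ (↥ p) (↧ₙ p))))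
    (ℤ.n<s[n/ℕd]*d (↥ p) (↧ₙ p)))

-- From `z ≤ p < floor p + 1`, because an integer below `floor p + 1` is at most `floor p`.
≤floor : ∀ {z p} → fromℤ z ℚ.≤ p → z ℤ.≤ floor p
≤floor {z} {p} z≤p = subst (z ℤ.≤_) (ℤ.pred-suc (floor p))
  (ℤ.i<j⇒i≤pred[j] (fromℤ-cancel-< {y = ℤ.suc (floor p)} (ℚ.≤-<-trans z≤p (<suc-floor p))))

∑-floor≤ : (v : Vector ℚ k) → fromℤ (∑ℤ (floor ∘ v)) ℚ.≤ ∑ℚ v
∑-floor≤ {zero}  v = ℚ.≤-refl
∑-floor≤ {suc k} v = begin
  fromℤ (floor v₀ + ∑ℤ (floor ∘ v ∘ suc))         ≡⟨ fromℤ-+ (floor v₀) _ ⟩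
  fromℤ (floor v₀) ℚ.+ fromℤ (∑ℤ (floor ∘ v ∘ suc)) ≤⟨ ℚ.+-mono-≤ (floor≤ v₀) (∑-floor≤ (v ∘ suc)) ⟩
  v₀ ℚ.+ ∑ℚ (v ∘ suc)                              ∎
  where
  open ℚ.≤-Reasoning
  v₀ = v zero

-- Each floor loses less than 1. The induction starts at one entry, since for an empty vector the
-- claim would be 0 < 0.
<∑-floor+k : (v : Vector ℚ (suc k)) → ∑ℚ v ℚ.< fromℤ (∑ℤ (floor ∘ v) + + suc k)
<∑-floor+k {zero} v = subst₂ ℚ._<_ (sym (ℚ.+-identityʳ (v zero)))
  (cong fromℤ (eq (floor (v zero)))) (<suc-floor (v zero))
  where
  eq : ∀ z → 1ℤ + z ≡ z + 0ℤ + 1ℤ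
  eq = solve-∀
<∑-floor+k {suc k} v = begin-strict
  v₀ ℚ.+ ∑ℚ (v ∘ suc)                             <⟨ ℚ.+-mono-< (<suc-floor v₀) (<∑-floor+k (v ∘ suc)) ⟩
  fromℤ (ℤ.suc (floor v₀)) ℚ.+ fromℤ (M + + suc k) ≡⟨ fromℤ-+ (ℤ.suc (floor v₀)) (M + + suc k) ⟨
  fromℤ (ℤ.suc (floor v₀) + (M + + suc k))         ≡⟨ cong fromℤ (eq (floor v₀) M (+ suc k)) ⟩
  fromℤ (floor v₀ + M + + suc (suc k))             ∎
  where
  open ℚ.≤-Reasoning
  v₀ = v zero
  M  = ∑ℤ (floor ∘ v ∘ suc)
  eq : ∀ x y z → 1ℤ + x + (y + z) ≡ x + y + (1ℤ + z)
  eq = solve-∀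

-- Tuples with a given total deficit

deficit : Vector ℤ k → Vec ℤ k → Vector ℤ k
deficit m t i = m i - lookup t i

-- Entries have no lower bound here; the fixed total deficit already leaves finitely many tuples.
Below : Vector ℤ k → ℕ → Vec ℤ k → Set
Below m n t = (∀ i → lookup t i ℤ.≤ m i) × ∑ℤ (deficit m t) ≡ + n

∑-deficit : (m : Vector ℤ k) (t : Vec ℤ k) → ∑ℤ (deficit m t) ≡ ∑ℤ m - ∑ℤ (lookup t)
∑-deficit m []      = refl
∑-deficit m (x ∷ t) = trans (cong (λ s → m zero - x + s) (∑-deficit (m ∘ suc) t))
  (eq (m zero) x (∑ℤ (m ∘ suc)) (∑ℤ (lookup t)))
  where
  eq : ∀ a b c d → a - b + (c - d) ≡ a + c - (b + d)
  eq = solve-∀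

deficit≤∑ : (m : Vector ℤ k) (t : Vec ℤ k) → (∀ i → lookup t i ℤ.≤ m i) →
            ∀ i → deficit m t i ℤ.≤ ∑ℤ (deficit m t)
deficit≤∑ m t t≤m = entry≤∑ℤ (deficit m t) (ℤ.i≤j⇒0≤j-i ∘ t≤m)

-- The recursion on n > 0 splits according to whether the first entry attains
-- its bound; this is Pascal's rule for the length.
tuplesBelow : ∀ k → Vector ℤ k → ℕ → List (Vec ℤ k)
tuplesBelow zero    m zero    = [] ∷ []
tuplesBelow zero    m (suc n) = []
tuplesBelow (suc k) m zero    = map (m zero ∷_) (tuplesBelow k (m ∘ suc) zero)
tuplesBelow (suc k) m (suc n) =
  map (m zero ∷_) (tuplesBelow k (m ∘ suc) (suc n)) ++
  tuplesBelow (suc k) (ℤ.pred (m zero) Vector.∷ m ∘ suc) n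

-- Stars and bars.

nC0≡1 : ∀ n → n C 0 ≡ 1
nC0≡1 n = trans (nCk≡nC[n∸k] {k = 0} {n = n} z≤n) (nCn≡1 n)

-- The deficits form `suc k` nonnegative parts of total `n`. The induction follows the recursion, so
-- `m` must vary.
length-tuplesBelow : ∀ k m n → length (tuplesBelow (suc k) m n) ≡ (n ℕ.+ k) C k
length-tuplesBelow zero    m zero    = refl
length-tuplesBelow zero    m (suc n) = begin
  length (tuplesBelow 1 _ n) ≡⟨ length-tuplesBelow zero _ n ⟩
  (n ℕ.+ 0) C 0              ≡⟨ nC0≡1 (n ℕ.+ 0) ⟩
  1                          ≡⟨ nC0≡1 (suc n ℕ.+ 0) ⟨
  (suc n ℕ.+ 0) C 0          ∎
  where open ≡-Reasoning
length-tuplesBelow (suc k) m zero    = begin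
  length (map (m zero ∷_) (tuplesBelow (suc k) (m ∘ suc) 0)) ≡⟨ length-map (m zero ∷_) (tuplesBelow (suc k) (m ∘ suc) 0) ⟩
  length (tuplesBelow (suc k) (m ∘ suc) 0) ≡⟨ length-tuplesBelow k (m ∘ suc) 0 ⟩
  k C k                                    ≡⟨ nCn≡1 k ⟩
  1                                        ≡⟨ nCn≡1 (suc k) ⟨
  suc k C suc k                            ∎
  where open ≡-Reasoning
length-tuplesBelow (suc k) m (suc n) = begin
  length (map (m zero ∷_) full ++ rest)       ≡⟨ length-++ (map (m zero ∷_) full) ⟩
  length (map (m zero ∷_) full) ℕ.+ length rest ≡⟨ cong (ℕ._+ length rest) (length-map (m zero ∷_) full) ⟩
  length full ℕ.+ length rest
    ≡⟨ cong₂ ℕ._+_ (length-tuplesBelow k (m ∘ suc) (suc n)) (length-tuplesBelow (suc k) _ n) ⟩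
  (suc n ℕ.+ k) C k ℕ.+ (n ℕ.+ suc k) C suc k
    -- Rewriting `n + suc k` as `suc n + k` gives both terms the same upper index, as Pascal's rule
    -- requires.
    ≡⟨ cong (λ l → (suc n ℕ.+ k) C k ℕ.+ l C suc k) (ℕ.+-suc n k) ⟩
  (suc n ℕ.+ k) C k ℕ.+ (suc n ℕ.+ k) C suc k ≡⟨ nCk+nC[k+1]≡[n+1]C[k+1] (suc n ℕ.+ k) k ⟩
  suc (suc n ℕ.+ k) C suc k                   ≡⟨ cong (_C suc k) (ℕ.+-suc (suc n) k) ⟨
  (suc n ℕ.+ suc k) C suc k                   ∎
  where
  open ≡-Reasoning
  full = tuplesBelow (suc k) (m ∘ suc) (suc n)
  rest = tuplesBelow (suc (suc k)) (ℤ.pred (m zero) Vector.∷ m ∘ suc) n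

-- Correctness of the enumeration.

private
  deficit-refl : ∀ x y → x - x + y ≡ y
  deficit-refl = solve-∀

  deficit-pred : ∀ x y z → x - y + z ≡ 1ℤ + (ℤ.-1ℤ + x - y + z)
  deficit-pred = solve-∀

below-∷ : ∀ {m : Vector ℤ (suc k)} {n t} → Below (m ∘ suc) n t → Below m n (m zero ∷ t)
below-∷ {m = m} (t≤m , ∑≡n) =
  (λ { zero → ℤ.≤-refl ; (suc i) → t≤m i }) , trans (deficit-refl (m zero) _) ∑≡n

∈-tuplesBelow⁻ : ∀ k (m : Vector ℤ k) n {t} → t ∈ tuplesBelow k m n → Below m n t
∈-tuplesBelow⁻ zero    m zero    {[]} _ = (λ ()) , refl
∈-tuplesBelow⁻ (suc k) m zero    t∈ with ∈-map⁻ (m zero ∷_) t∈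
... | s , s∈ , refl = below-∷ {m = m} (∈-tuplesBelow⁻ k (m ∘ suc) zero s∈)
∈-tuplesBelow⁻ (suc k) m (suc n) {t} t∈
  with ∈-++⁻ (map (m zero ∷_) (tuplesBelow k (m ∘ suc) (suc n))) t∈
... | inj₁ t∈full with ∈-map⁻ (m zero ∷_) t∈full
...   | s , s∈ , refl = below-∷ {m = m} (∈-tuplesBelow⁻ k (m ∘ suc) (suc n) s∈)
∈-tuplesBelow⁻ (suc k) m (suc n) {x ∷ t} t∈ | inj₂ t∈rest
  with t≤m , ∑≡n ← ∈-tuplesBelow⁻ (suc k) (ℤ.pred (m zero) Vector.∷ m ∘ suc) n t∈rest =
  (λ { zero    → ℤ.<⇒≤ (ℤ.i≤pred[j]⇒i<j (t≤m zero))
     ; (suc i) → t≤m (suc i) }) ,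
  trans (deficit-pred (m zero) x _) (cong ℤ.suc ∑≡n)

∈-tuplesBelow⁺ : ∀ k (m : Vector ℤ k) n {t} → Below m n t → t ∈ tuplesBelow k m n
∈-tuplesBelow⁺ zero    m zero    {[]}    _ = here refl
∈-tuplesBelow⁺ zero    m (suc n) {[]}    (_ , ())
∈-tuplesBelow⁺ (suc k) m n       {x ∷ t} (t≤m , ∑≡n) with x ℤ.≟ m zero
∈-tuplesBelow⁺ (suc k) m zero {x ∷ t} (t≤m , ∑≡n) | yes refl =
  ∈-map⁺ (x ∷_) (∈-tuplesBelow⁺ k (m ∘ suc) zero
    (t≤m ∘ suc , trans (sym (deficit-refl (m zero) _)) ∑≡n))
∈-tuplesBelow⁺ (suc k) m (suc n) {x ∷ t} (t≤m , ∑≡n) | yes refl =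
  ∈-++⁺ˡ (∈-map⁺ (x ∷_) (∈-tuplesBelow⁺ k (m ∘ suc) (suc n)
    (t≤m ∘ suc , trans (sym (deficit-refl (m zero) _)) ∑≡n)))
∈-tuplesBelow⁺ (suc k) m zero {x ∷ t} (t≤m , ∑≡n) | no x≢m₀ =
  -- Each deficit is at most the total, here 0, so the first entry cannot lie strictly below its
  -- bound.
  contradiction (ℤ.≤-antisym (t≤m zero) (ℤ.i-j≤0⇒i≤j
    (subst (m zero - x ℤ.≤_) ∑≡n (deficit≤∑ m (x ∷ t) t≤m zero)))) x≢m₀
∈-tuplesBelow⁺ (suc k) m (suc n) {x ∷ t} (t≤m , ∑≡n) | no x≢m₀ =
  ∈-++⁺ʳ (map (m zero ∷_) (tuplesBelow k (m ∘ suc) (suc n)))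
    (∈-tuplesBelow⁺ (suc k) (ℤ.pred (m zero) Vector.∷ m ∘ suc) n
      ( (λ { zero    → ℤ.i<j⇒i≤pred[j] (ℤ.≤∧≢⇒< (t≤m zero) x≢m₀)
           ; (suc i) → t≤m (suc i) })
      , +-cancelˡ 1ℤ _ _ (trans (sym (deficit-pred (m zero) x _)) ∑≡n)))

tuplesBelow-unique : ∀ k m n → Unique (tuplesBelow k m n)
tuplesBelow-unique zero    m zero    = [] ∷ []
tuplesBelow-unique zero    m (suc n) = []
tuplesBelow-unique (suc k) m zero    =
  Unique.map⁺ ∷-injectiveʳ (tuplesBelow-unique k (m ∘ suc) zero)
tuplesBelow-unique (suc k) m (suc n) = Unique.++⁺
  (Unique.map⁺ ∷-injectiveʳ (tuplesBelow-unique k (m ∘ suc) (suc n)))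
  (tuplesBelow-unique (suc k) m′ n)
  disjoint
  where
  m′ = ℤ.pred (m zero) Vector.∷ m ∘ suc
  disjoint : ∀ {t} → ¬ (t ∈ map (m zero ∷_) (tuplesBelow k (m ∘ suc) (suc n))
                        × t ∈ tuplesBelow (suc k) m′ n)
  -- On the left the first entry equals `m zero`; on the right it is at most `pred (m zero)`.
  disjoint (t∈full , t∈rest) with ∈-map⁻ (m zero ∷_) t∈full
  ... | s , _ , refl = ℤ.<-irrefl refl
    (ℤ.i≤pred[j]⇒i<j (proj₁ (∈-tuplesBelow⁻ (suc k) m′ n t∈rest) zero))

-- Duplicate-free lists with the same members are permutations of each other. This lets `f` be
-- computed from another enumeration.
unique∧set⇒length≡ : ∀ {A : Set} {xs ys : List A} → Unique xs → Unique ys →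
                     (∀ x → x ∈ xs ⇔ x ∈ ys) → length xs ≡ length ys
unique∧set⇒length≡ uxs uys eq =
  ↭-length (∼bag⇒↭ (unique∧set⇒bag uxs uys (λ {x} → eq x)))

∉⇒length≡0 : ∀ {A : Set} (xs : List A) → (∀ x → ¬ x ∈ xs) → length xs ≡ 0
∉⇒length≡0 []       _  = refl
∉⇒length≡0 (x ∷ xs) ∉xs = contradiction (here refl) (∉xs x)

-- The lower bound on `i` matters: at negative upper indices `binom` is nonzero.
binom-small : ∀ {i r} → 0ℤ ℤ.≤ i → i ℤ.< + r → binom i r ≡ 0ℤ
binom-small (+≤+ _) (+<+ n<r) = cong +_ (k>n⇒nCk≡0 n<r)

-- Counting communal tuples

module _ (α : Vector ℚ k) (g : ℕ) where

  bound : Vector ℤ k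
  bound i = floor (α i ℚ.* fromℤ (+ g))

  communal⇒≤bound : ∀ t → CommunalOfSum α g t → ∀ i → lookup t i ℤ.≤ bound i
  communal⇒≤bound t (communal , ∑≡g) i = ≤floor
    (subst (λ s → fromℤ (lookup t i) ℚ.≤ α i ℚ.* fromℤ s) ∑≡g (proj₂ (communal i)))

  communal⇒∑-deficit : ∀ t → CommunalOfSum α g t → ∑ℤ (deficit bound t) ≡ ∑ℤ bound - + g
  communal⇒∑-deficit t (_ , ∑≡g) =
    trans (∑-deficit bound t) (cong (λ s → ∑ℤ bound - s) ∑≡g)

  -- A communal tuple would have nonnegative deficits with a negative sum.
  f≡0 : ∀ {n} → ∑ℤ bound - + g ≡ -[1+ n ] → f α g ≡ 0
  f≡0 eq = ∉⇒length≡0 (communalTuples α g) λ t t∈ →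
    let c = Equivalence.to (∈-communalTuples α g t) t∈ in
    contradiction
      (subst (0ℤ ℤ.≤_) (trans (communal⇒∑-deficit t c) eq)
        (∑ℤ-nonneg (deficit bound t) (ℤ.i≤j⇒0≤j-i ∘ communal⇒≤bound t c)))
      λ ()

  communal⇔below : ∀ {n} → ∑ℤ bound - + g ≡ + n → (∀ i → + n ℤ.≤ bound i) →
                   ∀ t → CommunalOfSum α g t ⇔ Below bound n t
  communal⇔below {n} eq n≤bound t = mk⇔
    (λ c → communal⇒≤bound t c , trans (communal⇒∑-deficit t c) eq)
    λ (t≤bound , ∑≡n) →
      let ∑t≡g : ∑ℤ (lookup t) ≡ + g
          ∑t≡g = ℤ.neg-injective (+-cancelˡ (∑ℤ bound) _ _
            (trans (sym (∑-deficit bound t)) (trans ∑≡n (sym eq))))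
      in (λ i →
           -- Nonnegativity of the entry: its deficit is at most `n`, hence at most `bound i`.
           cancel (ℤ.≤-trans (deficit≤∑ bound t t≤bound i)
                     (subst (ℤ._≤ bound i) (sym ∑≡n) (n≤bound i))) ,
           subst (λ s → fromℤ (lookup t i) ℚ.≤ α i ℚ.* fromℤ s) (sym ∑t≡g)
             (ℚ.≤-trans (fromℤ-mono-≤ (t≤bound i)) (floor≤ _)))
         , ∑t≡g
    where
    cancel : ∀ {x y} → x - y ℤ.≤ x → 0ℤ ℤ.≤ y
    cancel {x} {y} x-y≤x =
      subst (0ℤ ℤ.≤_) (eq′ x y) (ℤ.i≤j⇒0≤j-i x-y≤x)
      where
      eq′ : ∀ x y → x - (x - y) ≡ y
      eq′ = solve-∀

  f≡length : ∀ {n} → ∑ℤ bound - + g ≡ + n → (∀ i → + n ℤ.≤ bound i) →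
             f α g ≡ length (tuplesBelow k bound n)
  f≡length {n} eq n≤bound = unique∧set⇒length≡
    (communalTuples-unique α g) (tuplesBelow-unique k bound n) λ t → mk⇔
      (λ t∈ → ∈-tuplesBelow⁺ k bound n
        (Equivalence.to (communal⇔below eq n≤bound t)
          (Equivalence.to (∈-communalTuples α g t) t∈)))
      (λ t∈ → Equivalence.from (∈-communalTuples α g t)
        (Equivalence.from (communal⇔below eq n≤bound t) (∈-tuplesBelow⁻ k bound n t∈)))

module _ (α : Vector ℚ (suc k)) (g : ℕ) where

  private
    γ = fromℤ (+ g)
    m = bound α g

    instance
      γ-nonNeg : ℚ.NonNegative γ
      γ-nonNeg = ℚ.nonNegative (fromℤ-mono-≤ {0ℤ} {+ g} (+≤+ z≤n))

  -- Removing `m i` from the excess leaves the sum of the other floors minus `g`. That sum is at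
  -- most `g` times the sum of the other `α j`, hence at most `g`.
  excess≤bound : (∀ (σ : Fin k → Fin (suc k)) → Injective _≡_ _≡_ σ → ∑ℚ (α ∘ σ) ℚ.≤ 1ℚ) →
                 ∀ i → ∑ℤ m - + g ℤ.≤ m i
  excess≤bound ∑≤1 i = ℤ.i-j≤0⇒i≤j (subst (ℤ._≤ 0ℤ) eq (ℤ.i≤j⇒i-j≤0 others≤g))
    where
    σ = punchIn i
    others≤g : ∑ℤ (m ∘ σ) ℤ.≤ + g
    others≤g = fromℤ-cancel-≤ (begin
      fromℤ (∑ℤ (m ∘ σ))          ≤⟨ ∑-floor≤ (λ j → α (σ j) ℚ.* γ) ⟩
      ∑ℚ (λ j → α (σ j) ℚ.* γ)    ≡⟨ *-distribʳ-sum γ (α ∘ σ) ⟨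
      ∑ℚ (α ∘ σ) ℚ.* γ            ≤⟨ ℚ.*-monoʳ-≤-nonNeg γ (∑≤1 σ (punchIn-injective i _ _)) ⟩
      1ℚ ℚ.* γ                    ≡⟨ ℚ.*-identityˡ γ ⟩
      γ                           ∎)
      where open ℚ.≤-Reasoning
    rearrange : ∀ a b c → b - c ≡ a + b - c - a
    rearrange = solve-∀
    eq : ∑ℤ (m ∘ σ) - + g ≡ ∑ℤ m - + g - m i
    eq = trans (rearrange (m i) (∑ℤ (m ∘ σ)) (+ g))
      (cong (λ s → s - + g - m i) (sym (sum-remove {i = i} m)))

  0≤excess+k : ∑ℚ α ℚ.> 1ℚ → 0ℤ ℤ.≤ ∑ℤ m - + g + + suc k - 1ℤ
  0≤excess+k ∑>1 = subst (0ℤ ℤ.≤_) (rearrange (∑ℤ m) (+ g) (+ suc k))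
    (ℤ.i≤j⇒0≤j-i (ℤ.i<j⇒suc[i]≤j (fromℤ-cancel-< {+ g} {∑ℤ m + + suc k} (begin-strict
      γ                              ≡⟨ ℚ.*-identityˡ γ ⟨
      1ℚ ℚ.* γ                       ≤⟨ ℚ.*-monoʳ-≤-nonNeg γ (ℚ.<⇒≤ ∑>1) ⟩
      ∑ℚ α ℚ.* γ                     ≡⟨ *-distribʳ-sum γ α ⟩
      ∑ℚ (λ i → α i ℚ.* γ)           <⟨ <∑-floor+k (λ i → α i ℚ.* γ) ⟩
      fromℤ (∑ℤ m + + suc k)         ∎))))
    where
    open ℚ.≤-Reasoning
    rearrange : ∀ a b c → a + c - (1ℤ + b) ≡ a - b + c - 1ℤ
    rearrange = solve-∀

excess-index : ∀ x k → x + + suc k - 1ℤ ≡ x + + k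
excess-index x k = rearrange x (+ k)
  where
  rearrange : ∀ x y → x + (1ℤ + y) - 1ℤ ≡ x + y
  rearrange = solve-∀

mainTheorem1 : (k : ℕ) → 2 ≤ k →
    (α : Vector ℚ k) →
    (∀ i → 0ℚ ℚ.≤ α i) →
    (∀ (σ : Fin (k ∸ 1) → Fin k) → Injective _≡_ _≡_ σ → ∑ℚ (α ∘ σ) ℚ.≤ 1ℚ) →
    ∑ℚ α ℚ.> 1ℚ →
    (g : ℕ) →
    + f α g ≡ binom (∑ℤ (λ i → floor (α i ℚ.* fromℤ (+ g))) - + g + + k - 1ℤ) (k ∸ 1)
mainTheorem1 (suc k) _ α _ ∑≤1 ∑>1 g = count (∑ℤ m - + g) refl
  where
  m = bound α g
  count : ∀ x → ∑ℤ m - + g ≡ x → + f α g ≡ binom (∑ℤ m - + g + + suc k - 1ℤ) k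
  count (+ n) eq = begin
    + f α g                               ≡⟨ cong +_ (f≡length α g eq λ i → subst (ℤ._≤ m i) eq (excess≤bound α g ∑≤1 i)) ⟩
    + length (tuplesBelow (suc k) m n)    ≡⟨ cong +_ (length-tuplesBelow k m n) ⟩
    binom (+ n + + k) k                   ≡⟨ cong (λ x → binom x k) (excess-index (+ n) k) ⟨
    binom (+ n + + suc k - 1ℤ) k          ≡⟨ cong (λ x → binom (x + + suc k - 1ℤ) k) eq ⟨
    binom (∑ℤ m - + g + + suc k - 1ℤ) k   ∎
    where open ≡-Reasoning
  count -[1+ n ] eq = trans (cong +_ (f≡0 α g eq)) (sym (binom-small (0≤excess+k α g ∑>1) (begin-strict
    ∑ℤ m - + g + + suc k - 1ℤ   ≡⟨ excess-index (∑ℤ m - + g) k ⟩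
    ∑ℤ m - + g + + k            ≡⟨ cong (λ x → x + + k) eq ⟩
    -[1+ n ] + + k              <⟨ ℤ.+-monoˡ-< (+ k) -<+ ⟩
    0ℤ + + k                    ≡⟨ ℤ.+-identityˡ (+ k) ⟩
    + k                         ∎)))
    where open ℤ.≤-Reasoning
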